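{- Suppose $\kappa$ is weakly compact. Let $\sigma,\delta>0$ be ordinals and assume $\delta,\sigma<\kappa$. Then $\mathrm{SDHL}'(\delta,\sigma,\kappa)$ holds if and only if $\mathrm{SDHL}(\delta,\sigma,\kappa)$ holds.
   Context: A cardinal $\kappa$ is weakly compact if it is strongly inaccessible and every $\kappa$-tree has a cofinal branch. A tree $T\subseteq {}^{<\kappa}\kappa$ is a set of sequences closed under initial segments, ordered by end-extension $\sqsubseteq$; $T(\zeta):=T\cap{}^{\zeta}\kappa$ is its $\zeta$-th level. "Successor" of a node always means immediate successor. $T$ is a $\kappa$-tree if $|T|=\kappa$ and every level of $T$ has cardinality less than $\kappa$. $T$ is perfect if every node of $T$ has an extension in $T$ which splits in $T$. $T\subseteq{}^{<\kappa}\kappa$ is regular if it is a perfect $\kappa$-tree in which every maximal branch has cofinality $\kappa$. $\mathrm{Cone}(t):=\{s\in{}^{<\kappa}\kappa:s\sqsupseteq t\}$. $X\subseteq{}^{<\kappa}\kappa$ dominates $Y\subseteq{}^{<\kappa}\kappa$ if $(\forall y\in Y)(\exists x\in X)\ y\sqsubseteq x$. Level-product: for an ordinal $\delta>0$ and $X_i\subseteq{}^{<\kappa}\kappa$ ($i<\delta$), with $X_i(\zeta):=X_i\cap{}^{\zeta}\kappa$, $\bigotimes_{i<\delta}X_i:=\{\langle x_i:i<\delta\rangle:(\exists\zeta<\kappa)(\forall i<\delta)\ x_i\in X_i(\zeta)\}$. $\mathrm{SDHL}(\delta,\sigma,\kappa)$ is the statement: given any sequence $\langle T_i\subseteq{}^{<\kappa}\kappa:i<\delta\rangle$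 of regular trees and any coloring $c:\bigotimes_{i<\delta}T_i\to\sigma$, there exist $\zeta<\zeta'<\kappa$, $\langle t_i\in T_i(\zeta):i<\delta\rangle$, and $\langle X_i\subseteq T_i(\zeta'):i<\delta\rangle$ such that each $X_i$ dominates $T_i(\zeta+1)\cap\mathrm{Cone}(t_i)$ and $|c[\bigotimes_{i<\delta}X_i]|=1$. A somewhere dense matrix for a sequence of regular trees $\langle T_i:i<\delta\rangle$ is a sequence of sets $\langle X_i\subseteq T_i:i<\delta\rangle$ such that there are nodes $t_i\in T_i$ ($i<\delta$), all of the same length, such that each $X_i$ dominates the set of all successors of $t_i$ in $T_i$. $\mathrm{SDHL}'(\delta,\sigma,\kappa)$ is the statement: for any sequence $\langle T_i\subseteq{}^{<\kappa}\kappa:i<\delta\rangle$ of regular trees, any coloring $c:\prod_{i<\delta}T_i\to\sigma$ of the full product is constant on $\prod_{i<\delta}X_i$ for some somewhere dense matrix $\langle X_i\subseteq T_i:i<\delta\rangle$. -}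

module Defs where

open import Data.Bool.Base using (Bool)
open import Data.Nat.Base using (ℕ)
open import Data.Product.Base using (Σ; Σ-syntax; ∃; ∃-syntax; _×_; _,_; proj₁; proj₂; map₂)
open import Data.Product using (∃!)
open import Data.Sum.Base using (_⊎_)
open import Function.Bundles using (Func; Injection; Bijection)
open import Induction.WellFounded using (WellFounded)
open import Level using (Level; suc; _⊔_)
open import Relation.Binary.Bundles using (Setoid; Poset)
open import Relation.Binary.Core using (Rel)
open import Relation.Binary.Definitions using (Irrelevant)
open import Relation.Binary.Structures using (IsStrictTotalOrder)
open import Relation.Binary.PropositionalEquality using (_≡_; refl; trans; setoid; _→-setoid_)
open import Relation.Nullary.Negation using (¬_)
open import Relation.Unary using (Pred; _∈_; _⊆_; _∩_)
import Relation.Binary.Construct.On as On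
import Relation.Binary.Construct.StrictToNonStrict as StrictToNonStrict

-- A set is a setoid, and cardinalities are compared by maps respecting
-- the setoid equalities.

infix 4 _≼_ _≺_ _≃ᶜ_

_≼_ _≺_ _≃ᶜ_ : ∀ {a ℓ₁ b ℓ₂} → Setoid a ℓ₁ → Setoid b ℓ₂ → Set (a ⊔ ℓ₁ ⊔ b ⊔ ℓ₂)
A ≼ B  = Injection A B
A ≺ B  = A ≼ B × ¬ (B ≼ A)
A ≃ᶜ B = Bijection A B

-- A predicate that does not respect _≈_ stands for its closure under _≈_.
subsetoid : ∀ {a ℓ p} (A : Setoid a ℓ) → Pred (Setoid.Carrier A) p → Setoid (a ⊔ p) ℓ
subsetoid A P = On.setoid {B = Σ (Setoid.Carrier A) P} A proj₁

module _ {ℓ} (P : Poset ℓ ℓ ℓ) where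
  open Poset P renaming (Carrier to A)

  IsCofinal : Pred A ℓ → Set ℓ
  IsCofinal Y = ∀ a → ∃[ y ] y ∈ Y × a ≤ y

  HasCofinality : Setoid ℓ ℓ → Set (suc ℓ)
  HasCofinality μ =
      (∃[ Y ] IsCofinal Y × subsetoid Eq.setoid Y ≃ᶜ μ)
    × (∀ Y → IsCofinal Y → μ ≼ subsetoid Eq.setoid Y)

-- An ordinal is a well-ordered type.  As for von Neumann ordinals, its
-- elements are the ordinals below it.
record Ordinal (ℓ : Level) : Set (suc ℓ) where
  infix 4 _<_
  field
    Carrier            : Set ℓ
    _<_                : Rel Carrier ℓ
    isStrictTotalOrder : IsStrictTotalOrder _≡_ _<_
    wellFounded        : WellFounded _<_
    -- Makes the initial segment Below α a subset of Carrier: an element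
    -- is not counted several times, once for each proof of β < α.
    <-irrelevant       : Irrelevant _<_

  open StrictToNonStrict _≡_ _<_ public using (_≤_)

  poset : Poset ℓ ℓ ℓ
  poset = record
    { isPartialOrder = StrictToNonStrict.isPartialOrder _≡_ _<_
        (IsStrictTotalOrder.isStrictPartialOrder isStrictTotalOrder) }

  asSet : Setoid ℓ ℓ
  asSet = setoid Carrier

  Below : Carrier → Set ℓ
  Below α = Σ[ β ∈ Carrier ] β < α

  Positive : Carrier → Set ℓ
  Positive α = ∃[ β ] β < α

  -- β = α + 1
  IsSuccessorOf : Carrier → Carrier → Set ℓ
  IsSuccessorOf α β = α < β × (∀ γ → α < γ → β ≤ γ)

module _ {ℓ} (κ : Ordinal ℓ) where
  open Ordinal κ

  record StronglyInaccessible : Set (suc ℓ) where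
    field
      cardinal    : ∀ α → setoid (Below α) ≺ asSet
      uncountable : setoid ℕ ≺ asSet
      regular     : HasCofinality poset asSet
      strongLimit : ∀ α → (Below α →-setoid Bool) ≺ asSet

  record Seq : Set ℓ where
    constructor ⟨_,_⟩
    field
      len : Carrier
      val : Below len → Carrier

  open Seq

  infix 4 _⊑_ _⊏_ _≈_

  -- Inclusion of graphs; in particular len s ≤ len t.
  _⊑_ : Rel Seq ℓ
  s ⊑ t = ∀ i (p : i < len s) → Σ[ q ∈ i < len t ] val s (i , p) ≡ val t (i , q)

  -- Set-theoretic equality of sequences, _≡_ not being extensional on
  -- the functions val.
  _≈_ : Rel Seq ℓ
  s ≈ t = s ⊑ t × t ⊑ s

  _⊏_ : Rel Seq ℓ
  s ⊏ t = s ⊑ t × ¬ (s ≈ t)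

  ⊑-refl : ∀ {s} → s ⊑ s
  ⊑-refl i p = p , refl

  ⊑-trans : ∀ {s t u} → s ⊑ t → t ⊑ u → s ⊑ u
  ⊑-trans s⊑t t⊑u i p with s⊑t i p
  ... | q , e with t⊑u i q
  ... | r , e′ = r , trans e e′

  seqPoset : Poset ℓ ℓ ℓ
  seqPoset = record
    { Carrier = Seq ; _≈_ = _≈_ ; _≤_ = _⊑_
    ; isPartialOrder = record
      { isPreorder = record
        { isEquivalence = record
          { refl  = λ {s} → ⊑-refl {s} , ⊑-refl {s}
          ; sym   = λ (p , q) → q , p
          ; trans = λ {s} {t} {u} (p , q) (p′ , q′) →
              ⊑-trans {s} {t} {u} p p′ , ⊑-trans {u} {t} {s} q′ q
          }
        ; reflexive = proj₁
        ; trans     = λ {s} {t} {u} → ⊑-trans {s} {t} {u}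
        }
      ; antisym = _,_
      }
    }

  seqSetoid : Setoid ℓ ℓ
  seqSetoid = Poset.Eq.setoid seqPoset

  Subset : Set (suc ℓ)
  Subset = Pred Seq ℓ

  Cone : Seq → Subset
  Cone t s = t ⊑ s

  infix 4 _Dominates_

  _Dominates_ : Subset → Subset → Set ℓ
  X Dominates Y = ∀ y → y ∈ Y → ∃[ x ] x ∈ X × y ⊑ x

  Level[_] : Subset → Carrier → Subset
  Level[ X ] ζ s = s ∈ X × len s ≡ ζ

  -- X(ζ + 1)
  NextLevel : Subset → Carrier → Subset
  NextLevel X ζ s = s ∈ X × IsSuccessorOf ζ (len s)

  IsTree : Subset → Set ℓ
  IsTree T = ∀ s t → t ∈ T → s ⊑ t → s ∈ T

  Successors : Subset → Seq → Subset
  Successors T t s = s ∈ T × t ⊏ s × ¬ (∃[ u ] u ∈ T × t ⊏ u × u ⊏ s)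

  Splits : Subset → Seq → Set ℓ
  Splits T t = ∃[ s ] ∃[ s′ ] s ∈ Successors T t × s′ ∈ Successors T t × ¬ (s ≈ s′)

  IsPerfect : Subset → Set ℓ
  IsPerfect T = ∀ t → t ∈ T → ∃[ s ] s ∈ T × t ⊑ s × Splits T s

  record IsκTree (T : Subset) : Set (suc ℓ) where
    field
      isTree : IsTree T
      size   : subsetoid seqSetoid T ≃ᶜ asSet
      levels : ∀ ζ → subsetoid seqSetoid (Level[ T ] ζ) ≺ asSet

  record IsBranch (T B : Subset) : Set ℓ where
    field
      inTree     : B ⊆ T
      linear     : ∀ s t → s ∈ B → t ∈ B → s ⊑ t ⊎ t ⊑ s
      downClosed : ∀ s t → t ∈ B → s ⊑ t → s ∈ B

  IsMaximalBranch : Subset → Subset → Set (suc ℓ)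
  IsMaximalBranch T B = IsBranch T B × (∀ C → IsBranch T C → B ⊆ C → C ⊆ B)

  IsCofinalBranch : Subset → Subset → Set ℓ
  IsCofinalBranch T B = IsBranch T B × (∀ ζ → ∃[ t ] t ∈ Level[ B ] ζ)

  record IsRegular (T : Subset) : Set (suc ℓ) where
    field
      isκTree  : IsκTree T
      perfect  : IsPerfect T
      branches : ∀ B → IsMaximalBranch T B →
                 HasCofinality (On.poset {B = Σ Seq B} seqPoset proj₁) asSet

  record WeaklyCompact : Set (suc ℓ) where
    field
      stronglyInaccessible : StronglyInaccessible
      treeProperty         : ∀ T → IsκTree T → ∃[ B ] IsCofinalBranch T B

  module _ (δ : Carrier) where

    Family : Set (suc ℓ)
    Family = Below δ → Subset

    infix 4 _⊆ᶠ_

    _⊆ᶠ_ : Family → Family → Set ℓ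
    X ⊆ᶠ Y = ∀ i → X i ⊆ Y i

    Tuple : Family → Set ℓ
    Tuple X = ∀ i → Σ Seq (X i)

    ∏ : Family → Setoid ℓ ℓ
    ∏ X = record
      { Carrier = Tuple X
      ; _≈_     = λ x y → ∀ i → proj₁ (x i) ≈ proj₁ (y i)
      ; isEquivalence = record
        { refl  = λ _ → S.refl
        ; sym   = λ e i → S.sym (e i)
        ; trans = λ e e′ i → S.trans (e i) (e′ i)
        }
      }
      where module S = Setoid seqSetoid

    LevelTuple : Family → Set ℓ
    LevelTuple X = Σ[ x ∈ Tuple X ] ∃[ ζ ] (∀ i → len (proj₁ (x i)) ≡ ζ)

    ⨂ : Family → Setoid ℓ ℓ
    ⨂ X = On.setoid {B = LevelTuple X} (∏ X) proj₁

    ∏-incl : ∀ {X Y} → X ⊆ᶠ Y → Tuple X → Tuple Y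
    ∏-incl X⊆Y x i = map₂ (X⊆Y i) (x i)

    ⨂-incl : ∀ {X Y} → X ⊆ᶠ Y → LevelTuple X → LevelTuple Y
    ⨂-incl {X} {Y} X⊆Y (x , ζ , e) = ∏-incl {X} {Y} X⊆Y x , ζ , e

    -- A function on the set S, that is, one respecting the equality of S.
    Colouring : Carrier → Setoid ℓ ℓ → Set ℓ
    Colouring σ S = Func S (setoid (Below σ))

    SDHL : Carrier → Set (suc ℓ)
    SDHL σ =
      (T : Family) → (∀ i → IsRegular (T i)) →
      (c : Colouring σ (⨂ T)) →
      Σ[ ζ ∈ Carrier ] Σ[ ζ′ ∈ Carrier ] ζ < ζ′ ×
      Σ[ t ∈ (Below δ → Seq) ] (∀ i → t i ∈ Level[ T i ] ζ) ×
      Σ[ X ∈ Family ]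
      Σ[ X⊆ ∈ (X ⊆ᶠ λ i → Level[ T i ] ζ′) ]
        (∀ i → X i Dominates (NextLevel (T i) ζ ∩ Cone (t i)))
      × ∃! _≡_ (λ γ → Σ[ x ∈ LevelTuple X ]
          Func.to c (⨂-incl {X} {T} (λ i x∈X → proj₁ (X⊆ i x∈X)) x) ≡ γ)

    IsSomewhereDenseMatrix : Family → Family → Set ℓ
    IsSomewhereDenseMatrix T X =
      X ⊆ᶠ T ×
      Σ[ t ∈ (Below δ → Seq) ] (∀ i → t i ∈ T i) ×
        (∃[ ζ ] (∀ i → len (t i) ≡ ζ)) ×
        (∀ i → X i Dominates Successors (T i) (t i))

    SDHL' : Carrier → Set (suc ℓ)
    SDHL' σ =
      (T : Family) → (∀ i → IsRegular (T i)) →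
      (c : Colouring σ (∏ T)) →
      Σ[ X ∈ Family ] Σ[ M ∈ IsSomewhereDenseMatrix T X ]
        (∀ x y → Func.to c (∏-incl {X} {T} (proj₁ M) x)
               ≡ Func.to c (∏-incl {X} {T} (proj₁ M) y))

{-# OPTIONS --safe #-}
-- From SDHL' to SDHL: choose for every node x of T i and every level η a node of T i of length η,
-- extending x if len x ≤ η.  For each η, colouring the tuples of the full product by the colour of
-- their chosen extensions at level η gives a colouring g η of ∏ T.  The restrictions of the g η to
-- tuples of bounded length form a κ-tree, κ being strongly inaccessible, and a cofinal branch is a
-- colouring of ∏ T that on the tuples of any given bounded length coincides with g η for arbitrarily
-- large η.  A somewhere dense matrix for it may be taken with nodes of bounded length, and its
-- extensions to a suitable level η are then as required.
--
-- From SDHL to SDHL': restrict the colouring to the level product, and use that the immediate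
-- successors of a node of length ζ are its extensions of length ζ + 1.
module Submission where

open import Defs
open import Level using (suc; Lift; lift; lower)
open import Axiom.ExcludedMiddle using (ExcludedMiddle)
open import Data.Bool.Base using (Bool; true)
open import Data.Bool.Properties using (⇔→≡)
open import Data.Product.Base using (Σ; Σ-syntax; ∃; ∃-syntax; _×_; _,_; proj₁; proj₂)
open import Data.Product.Relation.Binary.Lex.Strict using (×-Lex; ×-wellFounded; ×-compare)
open import Data.Sum.Base using (_⊎_; inj₁; inj₂; swap)
open import Data.Sum.Relation.Binary.Pointwise using (_⊎ₛ_; inj₁; inj₂)
open import Data.Unit.Base using (⊤; tt)
open import Function.Base using (const)
open import Function.Bundles using (_⇔_; mk⇔; Func; Injection; Bijection)
open import Function.Construct.Composition using (injection)
open import Function.Relation.Binary.Setoid.Equality using (_⇨_)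
open import Induction.WellFounded using (Acc; acc; WellFounded; WfRec; module All; module FixPoint)
open import Relation.Binary.Bundles using (Setoid; Poset)
open import Relation.Binary.Core using (Rel)
open import Relation.Binary.Definitions using (tri<; tri≈; tri>)
open import Relation.Binary.Structures using (IsStrictTotalOrder)
open import Relation.Binary.PropositionalEquality using (_≡_; refl; sym; trans; cong; cong₂; subst; setoid; _→-setoid_)
open import Relation.Nullary.Decidable using (Dec; yes; no; does; map′; decidable-stable; dec-true; dec-false; does-⇔)
open import Relation.Nullary.Negation using (¬_; contradiction)
open import Relation.Unary using (Pred; _∈_)

-- Deciding propositions and turning them into truth values.

module Classical {ℓ} (em : ExcludedMiddle (suc ℓ)) where

  dec : (P : Set ℓ) → Dec P
  dec P = map′ lower lift (em {Lift (suc ℓ) P})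

  byContradiction : {P : Set ℓ} → ¬ ¬ P → P
  byContradiction = decidable-stable (dec _)

  ⌊_⌋ : Set ℓ → Bool
  ⌊ P ⌋ = does (dec P)

  ⌊⌋-true : {P : Set ℓ} → P → ⌊ P ⌋ ≡ true
  ⌊⌋-true = dec-true (dec _)

  ⌊⌋-witness : {P : Set ℓ} → ⌊ P ⌋ ≡ true → P
  ⌊⌋-witness e = byContradiction λ ¬p → contradiction (trans (sym e) (dec-false (dec _) ¬p)) λ ()

  ⌊⌋-cong : {P Q : Set ℓ} → (P → Q) → (Q → P) → ⌊ P ⌋ ≡ ⌊ Q ⌋
  ⌊⌋-cong f g = does-⇔ (mk⇔ f g) (dec _) (dec _)

subsetoid-≼ : ∀ {a ℓ p q} (A : Setoid a ℓ) {P : Pred (Setoid.Carrier A) p} {Q : Pred (Setoid.Carrier A) q} →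
              (∀ x → P x → Q x) → subsetoid A P ≼ subsetoid A Q
subsetoid-≼ A P⊆Q = record
  { to = λ (x , p) → x , P⊆Q x p ; cong = λ e → e ; injective = λ e → e }

-- The order of an ordinal and least witnesses.

module OrdinalProperties {ℓ} (em : ExcludedMiddle (suc ℓ)) (κ : Ordinal ℓ) where
  open Classical em
  open Ordinal κ
  open IsStrictTotalOrder isStrictTotalOrder public
    using (compare) renaming (trans to <-trans; irrefl to <-irrefl)
  open Poset poset public using () renaming (trans to ≤-trans; antisym to ≤-antisym)

  <-≤-trans : ∀ {α β γ} → α < β → β ≤ γ → α < γ
  <-≤-trans p (inj₁ q)    = <-trans p q
  <-≤-trans p (inj₂ refl) = p

  ≤-<-trans : ∀ {α β γ} → α ≤ β → β < γ → α < γ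
  ≤-<-trans (inj₁ p) q    = <-trans p q
  ≤-<-trans (inj₂ refl) q = q

  <⇒≱ : ∀ {α β} → α < β → ¬ (β ≤ α)
  <⇒≱ p q = <-irrefl refl (<-≤-trans p q)

  ≮⇒≥ : ∀ {α β} → ¬ (α < β) → β ≤ α
  ≮⇒≥ {α} {β} α≮β with compare α β
  ... | tri< α<β _ _ = contradiction α<β α≮β
  ... | tri≈ _ α≡β _ = inj₂ (sym α≡β)
  ... | tri> _ _ β<α = inj₁ β<α

  ≤-total : ∀ α β → α ≤ β ⊎ β ≤ α
  ≤-total α β with compare α β
  ... | tri< α<β _ _ = inj₁ (inj₁ α<β)
  ... | tri≈ _ α≡β _ = inj₁ (inj₂ α≡β)
  ... | tri> _ _ β<α = inj₂ (inj₁ β<α)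

  upperBound : ∀ α β → ∃[ γ ] α ≤ γ × β ≤ γ
  upperBound α β with ≤-total α β
  ... | inj₁ α≤β = β , α≤β , inj₂ refl
  ... | inj₂ β≤α = α , inj₂ refl , β≤α

  Below-≡ : ∀ {α} {b c : Below α} → proj₁ b ≡ proj₁ c → b ≡ c
  Below-≡ {b = β , p} {_ , q} refl = cong (β ,_) (<-irrelevant p q)

  least : (P : Pred Carrier ℓ) → ∃ P → ∃[ m ] P m × (∀ n → P n → m ≤ n)
  least P (n , p) = go n (wellFounded n) p
    where
    go : ∀ n → Acc _<_ n → P n → ∃[ m ] P m × (∀ n → P n → m ≤ n)
    go n (acc rs) p with dec (∃[ m ] m < n × P m)
    ... | yes (m , m<n , q) = go m (rs m<n) q
    ... | no  ¬q            = n , p , λ m q → ≮⇒≥ λ m<n → ¬q (m , m<n , q)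

  -- By this, least witnesses are choices that respect a setoid equality: equal arguments yield
  -- equivalent predicates, hence the same choice.
  least-cong : ∀ {P Q : Pred Carrier ℓ} → (∀ n → P n → Q n) → (∀ n → Q n → P n) →
               (p : ∃ P) (q : ∃ Q) → proj₁ (least P p) ≡ proj₁ (least Q q)
  least-cong {P} {Q} P⊆Q Q⊆P p q with least P p | least Q q
  ... | m , Pm , m≤ | n , Qn , n≤ = ≤-antisym (m≤ n (Q⊆P n Qn)) (n≤ m (P⊆Q m Pm))

-- Cardinal arithmetic below a strongly inaccessible cardinal.

module Smallness {ℓ} (em : ExcludedMiddle (suc ℓ)) (κ : Ordinal ℓ) (inaccessible : StronglyInaccessible κ) where
  open Classical em
  open Ordinal κ
  open OrdinalProperties em κ
  open StronglyInaccessible inaccessible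

  abstract
    -- The image of an unbounded `f` is cofinal, so regularity embeds `κ` into it. Elements of the
    -- image carry preimages, and reading these off embeds `κ` into `A`.
    bounded : (A : Setoid ℓ ℓ) → ¬ (asSet ≼ A) → (f : Func A asSet) →
              ∃[ μ ] (∀ a → Func.to f a < μ)
    bounded A κ⋠A f = byContradiction λ unbounded →
      let image : Pred Carrier ℓ
          image y = ∃[ a ] Func.to f a ≡ y
          cofinal : IsCofinal poset image
          cofinal μ = byContradiction λ none → unbounded (μ , λ a → byContradiction λ fa≮μ →
            none (Func.to f a , (a , refl) , ≮⇒≥ fa≮μ))
          j = proj₂ regular image cofinal
          preimage = λ k → proj₂ (Injection.to j k)
      in κ⋠A record
        { to = λ k → proj₁ (preimage k)
        ; cong = λ { refl → Setoid.refl A }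
        ; injective = λ {k} {k′} e → Injection.injective j
            (trans (sym (proj₂ (preimage k))) (trans (Func.cong f e) (proj₂ (preimage k′))))
        }

    -- The least `ν` with `R a ν` respects the equality of `A`, so `bounded` applies to it;
    -- monotonicity of `R` then passes to the common bound.
    collect : (A : Setoid ℓ ℓ) → ¬ (asSet ≼ A) → let open Setoid A using () renaming (Carrier to X; _≈_ to _~_) in
              (R : X → Carrier → Set ℓ) →
              (∀ {a b ν} → a ~ b → R a ν → R b ν) →
              (∀ {a ν ν′} → ν ≤ ν′ → R a ν → R a ν′) →
              (∀ a → ∃ (R a)) → ∃[ ν ] (∀ a → R a ν)
    collect A κ⋠A R resp mono total with bounded A κ⋠A record
      { to   = λ a → proj₁ (least (R a) (total a))
      ; cong = λ e → least-cong (λ _ → resp e) (λ _ → resp (Setoid.sym A e)) _ _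
      }
    ... | ν , bound = ν , λ a → mono (inj₁ (bound a)) (proj₁ (proj₂ (least (R a) (total a))))

    collectBelow : ∀ α (R : Below α → Carrier → Set ℓ) →
                   (∀ {a ν ν′} → ν ≤ ν′ → R a ν → R a ν′) →
                   (∀ a → ∃ (R a)) → ∃[ ν ] (∀ a → R a ν)
    collectBelow α R = collect (setoid (Below α)) (proj₂ (cardinal α)) R λ { refl r → r }

    -- A one-point set cannot receive `κ`, because `ℕ` embeds into `κ`; so the constant function
    -- with value `α` is bounded.
    above : ∀ α → ∃[ β ] α < β
    above α with bounded (setoid (Lift ℓ ⊤)) κ⋠⊤ record { to = const α ; cong = λ _ → refl }
      where
      κ⋠⊤ : ¬ (asSet ≼ setoid (Lift ℓ ⊤))
      κ⋠⊤ j with Injection.injective (injection (proj₁ uncountable) j) {0} {1} refl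
      ... | ()
    ... | β , bound = β , bound (lift tt)

    successor : ∀ α → ∃[ β ] IsSuccessorOf α β
    successor α = least (α <_) (above α)

  Small : Setoid ℓ ℓ → Set ℓ
  Small A = ∃[ α ] A ≼ setoid (Below α)

  small⇒≺ : ∀ {A} → Small A → A ≺ asSet
  small⇒≺ (α , j) = injection j (proj₁ (cardinal α)) , λ k → proj₂ (cardinal α) (injection k j)

  bounded⇒small : ∀ {A} (j : A ≼ asSet) → ∃[ μ ] (∀ a → Injection.to j a < μ) → Small A
  bounded⇒small j (μ , bound) = μ , record
    { to        = λ a → Injection.to j a , bound a
    ; cong      = λ e → Below-≡ (Injection.cong j e)
    ; injective = λ e → Injection.injective j (cong proj₁ e)
    }

  ≺⇒small : ∀ {A} → A ≺ asSet → Small A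
  ≺⇒small {A} (j , κ⋠A) = bounded⇒small j (bounded A κ⋠A (Injection.function j))

  small-≼ : ∀ {A B} → A ≼ B → Small B → Small A
  small-≼ j (α , k) = α , injection j k

  small-Below : ∀ α → Small (setoid (Below α))
  small-Below α = ≺⇒small (cardinal α)

  -- A subset of `A` is replaced by its image under `j`, a subset of `Below α`, to which the strong
  -- limit property applies.
  small-power : ∀ {A} → Small A → Small (A ⇨ setoid Bool)
  small-power {A} (α , j) = small-≼ power (≺⇒small (strongLimit α))
    where
    open Injection j using (to; injective) renaming (cong to to-cong)
    power : (A ⇨ setoid Bool) ≼ (Below α →-setoid Bool)
    power = record
      { to        = λ f β → ⌊ (∃[ a ] to a ≡ β × Func.to f a ≡ true) ⌋
      ; cong      = λ e β → ⌊⌋-cong (λ (a , p , q) → a , p , trans (sym (e a)) q)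
                                    (λ (a , p , q) → a , p , trans (e a) q)
      ; injective = λ {f} {g} e a → ⇔→≡ (mk⇔ (transfer f g a (e (to a)))
                                             (transfer g f a (sym (e (to a)))))
      }
      where
      transfer : ∀ (f g : Func A (setoid Bool)) a →
        ⌊ (∃[ b ] to b ≡ to a × Func.to f b ≡ true) ⌋ ≡ ⌊ (∃[ b ] to b ≡ to a × Func.to g b ≡ true) ⌋ →
        Func.to f a ≡ true → Func.to g a ≡ true
      transfer f g a e fa with ⌊⌋-witness (trans (sym e) (⌊⌋-true (a , refl , fa)))
      ... | b , p , gb = trans (Func.cong g (injective (sym p))) gb

  -- The second summand is moved into the cofinal set of ordinals ≥ α, which contains a copy of κ.
  small-⊎ : ∀ {A B} → Small A → Small B → Small (A ⊎ₛ B)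
  small-⊎ {A} {B} (α , i) SB@(β , j) = bounded⇒small inject (bound , below)
    where
    upper : asSet ≼ subsetoid (Poset.Eq.setoid poset) (α ≤_)
    upper = proj₂ regular (α ≤_) (upperBound α)
    k : B ≼ subsetoid (Poset.Eq.setoid poset) (α ≤_)
    k = injection (proj₁ (small⇒≺ SB)) upper
    separate : ∀ a b → ¬ (proj₁ (Injection.to i a) ≡ proj₁ (Injection.to k b))
    separate a b e = <⇒≱ (proj₂ (Injection.to i a)) (subst (α ≤_) (sym e) (proj₂ (Injection.to k b)))
    inject : (A ⊎ₛ B) ≼ asSet
    inject = record
      { to        = λ { (inj₁ a) → proj₁ (Injection.to i a) ; (inj₂ b) → proj₁ (Injection.to k b) }
      ; cong      = λ { (inj₁ e) → cong proj₁ (Injection.cong i e) ; (inj₂ e) → Injection.cong k e }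
      ; injective = λ { {inj₁ a} {inj₁ a′} e → inj₁ (Injection.injective i (Below-≡ e))
                      ; {inj₁ a} {inj₂ b}  e → contradiction e (separate a b)
                      ; {inj₂ b} {inj₁ a}  e → contradiction (sym e) (separate a b)
                      ; {inj₂ b} {inj₂ b′} e → inj₂ (Injection.injective k e) }
      }
    rightBound : ∃[ μ ] (∀ b → proj₁ (Injection.to k b) < μ)
    rightBound = bounded B (proj₂ (small⇒≺ SB)) record
      { to = λ b → proj₁ (Injection.to k b) ; cong = Injection.cong k }
    bound = proj₁ (upperBound α (proj₁ rightBound))
    below : ∀ x → Injection.to inject x < bound
    below (inj₁ a) = <-≤-trans (proj₂ (Injection.to i a)) (proj₁ (proj₂ (upperBound α _)))
    below (inj₂ b) = <-≤-trans (proj₂ rightBound b) (proj₂ (proj₂ (upperBound α _)))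

  -- A function f is determined by the subsets of I ⊎ A that contain f i whenever they contain i.
  small-⇨ : ∀ {I A} → Small I → Small A → Small (I ⇨ A)
  small-⇨ {I} {A} SI SA = small-≼ code (small-power (small-power (small-⊎ SI SA)))
    where
    module I = Setoid I
    module A = Setoid A
    P = (I ⊎ₛ A) ⇨ setoid Bool
    Closed : Func I A → Setoid.Carrier P → Set ℓ
    Closed f S = ∀ i → Func.to S (inj₁ i) ≡ true → Func.to S (inj₂ (Func.to f i)) ≡ true
    -- The test set containing just `i` and `f i`. It is closed under `f`; if it is also closed
    -- under `g`, then `g i` equals `f i`.
    graph : Func I A → I.Carrier → Setoid.Carrier P
    graph f i = record
      { to   = λ { (inj₁ j) → ⌊ j I.≈ i ⌋ ; (inj₂ a) → ⌊ a A.≈ Func.to f i ⌋ }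
      ; cong = λ { (inj₁ e) → ⌊⌋-cong (I.trans (I.sym e)) (I.trans e)
                 ; (inj₂ e) → ⌊⌋-cong (A.trans (A.sym e)) (A.trans e) }
      }
    graph-closed : ∀ f i → Closed f (graph f i)
    graph-closed f i j j≈i = ⌊⌋-true (Func.cong f (⌊⌋-witness j≈i))
    code : (I ⇨ A) ≼ (P ⇨ setoid Bool)
    code = record
      { to = λ f → record
        { to   = λ S → ⌊ Closed f S ⌋
        ; cong = λ {S} {S′} e → ⌊⌋-cong
            (λ c i p → trans (sym (e (inj₂ (Func.to f i)))) (c i (trans (e (inj₁ i)) p)))
            (λ c i p → trans (e (inj₂ (Func.to f i))) (c i (trans (sym (e (inj₁ i))) p)))
        }
      ; cong = λ {f} {g} e S → ⌊⌋-cong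
          (λ c i p → trans (Func.cong S (inj₂ (A.sym (e i)))) (c i p))
          (λ c i p → trans (Func.cong S (inj₂ (e i))) (c i p))
      ; injective = λ {f} {g} e i → A.sym (⌊⌋-witness
          (⌊⌋-witness (trans (sym (e (graph f i))) (⌊⌋-true (graph-closed f i))) i (⌊⌋-true I.refl)))
      }

  -- Sets of cardinality exactly `κ`, by collapsing a well-order.

  infix 4 _◁_
  _◁_ : Rel (Carrier × Carrier) ℓ
  _◁_ = ×-Lex _≡_ _<_ _<_

  ◁-wellFounded : WellFounded _◁_
  ◁-wellFounded = ×-wellFounded wellFounded wellFounded

  -- A is well-ordered through k, with initial segments too small to be cofinal in κ; so A is
  -- isomorphic to κ, by the map sending a to the least ordinal above the images of its predecessors.
  module Collapse (A : Setoid ℓ ℓ) (k : A ≼ setoid (Carrier × Carrier))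
    (fibres : ∀ ζ → ¬ (asSet ≼ subsetoid A (λ a → proj₁ (Injection.to k a) ≡ ζ)))
    (κ≼A : asSet ≼ A) where

    private module A = Setoid A
    open Injection k using () renaming (to to key; cong to key-cong; injective to key-injective)

    -- A total form of `least`, so that the recursion can be set up before bounds are known to
    -- exist. The default value is arbitrary and is ruled out for `rank` by `strictBound`.
    leastOrJunk : Pred Carrier ℓ → Carrier
    leastOrJunk P with dec (∃ P)
    ... | yes p = proj₁ (least P p)
    ... | no  _ = Injection.to (proj₁ uncountable) 0

    leastOrJunk-cong : ∀ {P Q : Pred Carrier ℓ} → (∀ n → P n → Q n) → (∀ n → Q n → P n) →
                       leastOrJunk P ≡ leastOrJunk Q
    leastOrJunk-cong {P} {Q} P⊆Q Q⊆P with dec (∃ P) | dec (∃ Q)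
    ... | yes p       | yes q       = least-cong P⊆Q Q⊆P p q
    ... | yes (n , p) | no ¬q       = contradiction (n , P⊆Q n p) ¬q
    ... | no ¬p       | yes (n , q) = contradiction (n , Q⊆P n q) ¬p
    ... | no _        | no _        = refl

    leastOrJunk-least : ∀ {P : Pred Carrier ℓ} → ∃ P →
                        P (leastOrJunk P) × (∀ n → P n → leastOrJunk P ≤ n)
    leastOrJunk-least {P} p with dec (∃ P)
    ... | yes p′ = proj₂ (least P p′)
    ... | no ¬p  = contradiction p ¬p

    step : ∀ q → WfRec _◁_ (const Carrier) q → Carrier
    step q IH = leastOrJunk λ γ → ∀ a (p : key a ◁ q) → IH p < γ

    step-ext : ∀ q {IH IH′ : WfRec _◁_ (const Carrier) q} →
               (∀ {r} (p : r ◁ q) → IH p ≡ IH′ p) → step q IH ≡ step q IH′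
    step-ext q e = leastOrJunk-cong
      (λ γ h a p → subst (_< γ) (e p) (h a p))
      (λ γ h a p → subst (_< γ) (sym (e p)) (h a p))

    StrictBound : (Carrier × Carrier → Carrier) → Carrier × Carrier → Carrier → Set ℓ
    StrictBound f q γ = ∀ a → key a ◁ q → f (key a) < γ

    abstract
      rank : Carrier × Carrier → Carrier
      rank = All.wfRec ◁-wellFounded ℓ (const Carrier) step

      rank-unfold : ∀ q → rank q ≡ leastOrJunk (StrictBound rank q)
      rank-unfold q = FixPoint.unfold-wfRec ◁-wellFounded (const Carrier) step step-ext {q}

    -- Predecessors of a pair with first component `ζ` lie in fibres over ordinals up to `ζ`. Each
    -- fibre has bounded ranks, and regularity bounds them jointly; `θ` exceeds `ζ` so that the
    -- fibre over `ζ` is included.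
    strictBound : ∀ q → ∃ (StrictBound rank q)
    strictBound (ζ , _) =
      let θ , ζ<θ = above ζ
          ν , h   = collectBelow θ (λ (ξ , _) ν → ∀ a → proj₁ (key a) ≡ ξ → rank (key a) < ν)
                      (λ ν≤ν′ h a e → <-≤-trans (h a e) ν≤ν′)
                      (λ (ξ , _) → let ν , h = bounded _ (fibres ξ) record
                                         { to   = λ (a , _) → rank (key a)
                                         ; cong = λ e → cong rank (key-cong e) }
                                   in ν , λ a e → h (a , e))
      in ν , λ { a (inj₁ ξ<ζ)       → h (_ , <-trans ξ<ζ ζ<θ) a refl
               ; a (inj₂ (ξ≡ζ , _)) → h (ζ , ζ<θ) a ξ≡ζ }

    rank-bound : ∀ q → StrictBound rank q (rank q)
    rank-bound q = subst (StrictBound rank q) (sym (rank-unfold q)) (proj₁ (leastOrJunk-least (strictBound q)))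

    rank-least : ∀ q γ → StrictBound rank q γ → rank q ≤ γ
    rank-least q γ h = subst (_≤ γ) (sym (rank-unfold q)) (proj₂ (leastOrJunk-least (strictBound q)) γ h)

    rank-injective : ∀ {a b} → rank (key a) ≡ rank (key b) → a A.≈ b
    rank-injective {a} {b} e with ×-compare {_<₁_ = _<_} {_<₂_ = _<_} sym compare compare (key a) (key b)
    ... | tri< a◁b _ _       = contradiction (rank-bound (key b) a a◁b) (<-irrefl e)
    ... | tri≈ _ (e₁ , e₂) _ = key-injective (cong₂ _,_ e₁ e₂)
    ... | tri> _ _ b◁a       = contradiction (rank-bound (key a) b b◁a) (<-irrefl (sym e))

    embedding : A ≼ asSet
    embedding = record
      { to = λ a → rank (key a) ; cong = λ e → cong rank (key-cong e) ; injective = rank-injective }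

    -- Otherwise `embedding` would make `A` small, against `κ≼A`.
    rank-unbounded : ∀ γ → ∃[ a ] γ ≤ rank (key a)
    rank-unbounded γ = byContradiction λ none → proj₂ (small⇒≺ (bounded⇒small embedding
      (γ , λ a → byContradiction λ ≮γ → none (a , ≮⇒≥ ≮γ)))) κ≼A

    -- Take the least rank `m` that is at least `γ`, attained at `a`. If `γ < m`, minimality puts
    -- the ranks of all predecessors of `a` below `γ`, so the rank of `a` is at most `γ`, a
    -- contradiction.
    rank-surjective : ∀ γ → ∃[ a ] rank (key a) ≡ γ
    rank-surjective γ
      with least (λ m → γ ≤ m × ∃[ a ] rank (key a) ≡ m)
                 (let a , γ≤ = rank-unbounded γ in _ , γ≤ , a , refl)
    ... | _ , (inj₂ γ≡m , a , e)    , _     = a , trans e (sym γ≡m)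
    ... | _ , (inj₁ γ<m , a , refl) , m≤ = contradiction
      (rank-least (key a) γ λ b b◁a → byContradiction λ ≮γ →
        <⇒≱ (rank-bound (key a) b b◁a) (m≤ _ (≮⇒≥ ≮γ , b , refl)))
      (<⇒≱ γ<m)

    bijection : A ≃ᶜ asSet
    bijection = record
      { to        = λ a → rank (key a)
      ; cong      = Injection.cong embedding
      ; bijective = rank-injective , λ γ → let a , e = rank-surjective γ in
          a , λ b≈a → trans (Injection.cong embedding b≈a) e
      }

-- Initial segments, immediate successors and branches.

module Sequences {ℓ} (em : ExcludedMiddle (suc ℓ)) (κ : Ordinal ℓ) where
  open Ordinal κ
  open OrdinalProperties em κ
  open Seq public using (len; val)

  infix 4 _⊑ˢ_ _≈ˢ_
  _⊑ˢ_ _≈ˢ_ : Rel (Seq κ) ℓ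
  _⊑ˢ_ = _⊑_ κ
  _≈ˢ_ = _≈_ κ

  ⊑ˢ-refl : ∀ s → s ⊑ˢ s
  ⊑ˢ-refl s = ⊑-refl κ {s}

  ⊑ˢ-trans : ∀ s t u → s ⊑ˢ t → t ⊑ˢ u → s ⊑ˢ u
  ⊑ˢ-trans s t u = ⊑-trans κ {s} {t} {u}

  ⊑⇒len≤ : ∀ s t → s ⊑ˢ t → len s ≤ len t
  ⊑⇒len≤ s t s⊑t = ≮⇒≥ λ t<s → <-irrefl refl (proj₁ (s⊑t (len t) t<s))

  ≈⇒len≡ : ∀ s t → s ≈ˢ t → len s ≡ len t
  ≈⇒len≡ s t (s⊑t , t⊑s) = ≤-antisym (⊑⇒len≤ s t s⊑t) (⊑⇒len≤ t s t⊑s)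

  prefixes-⊑ : ∀ s t u → s ⊑ˢ u → t ⊑ˢ u → len s ≤ len t → s ⊑ˢ t
  prefixes-⊑ s t u s⊑u t⊑u s≤t i p with s⊑u i p | t⊑u i (<-≤-trans p s≤t)
  ... | q , e | q′ , e′ = <-≤-trans p s≤t , trans e (trans (cong (val u) (Below-≡ refl)) (sym e′))

  prefixes-comparable : ∀ s t u → s ⊑ˢ u → t ⊑ˢ u → s ⊑ˢ t ⊎ t ⊑ˢ s
  prefixes-comparable s t u s⊑u t⊑u with ≤-total (len s) (len t)
  ... | inj₁ s≤t = inj₁ (prefixes-⊑ s t u s⊑u t⊑u s≤t)
  ... | inj₂ t≤s = inj₂ (prefixes-⊑ t s u t⊑u s⊑u t≤s)

  comparable-⊑ : ∀ s t → s ⊑ˢ t ⊎ t ⊑ˢ s → len s ≤ len t → s ⊑ˢ t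
  comparable-⊑ s t (inj₁ s⊑t) _   = s⊑t
  comparable-⊑ s t (inj₂ t⊑s) s≤t = prefixes-⊑ s t s (⊑ˢ-refl s) t⊑s s≤t

  ⊏⇒len< : ∀ s t → _⊏_ κ s t → len s < len t
  ⊏⇒len< s t (s⊑t , s≉t) with ⊑⇒len≤ s t s⊑t
  ... | inj₁ s<t = s<t
  ... | inj₂ s≡t = contradiction (s⊑t , comparable-⊑ t s (inj₂ s⊑t) (inj₂ (sym s≡t))) s≉t

  restrict : ∀ (s : Seq κ) η → η ≤ len s → Seq κ
  restrict s η η≤ = ⟨ η , (λ (i , p) → val s (i , <-≤-trans p η≤)) ⟩

  restrict-⊑ : ∀ s η η≤ → restrict s η η≤ ⊑ˢ s
  restrict-⊑ s η η≤ i p = <-≤-trans p η≤ , refl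

  ⊏-intro : ∀ s t → s ⊑ˢ t → len s < len t → _⊏_ κ s t
  ⊏-intro s t s⊑t s<t = s⊑t , λ s≈t → <-irrefl (≈⇒len≡ s t s≈t) s<t

  -- If a length `γ` lay strictly between those of `t` and `s`, the restriction of `s` to `γ` would
  -- be a node of the tree strictly between them.
  successors⇒nextLevel : ∀ {T} → IsTree κ T → ∀ t s → Successors κ T t s → NextLevel κ T (len t) s
  successors⇒nextLevel tree t s (s∈T , t⊏s , none) =
    s∈T , ⊏⇒len< t s t⊏s , λ γ t<γ → ≮⇒≥ λ γ<s →
      let u   = restrict s γ (inj₁ γ<s)
          u⊑s = restrict-⊑ s γ (inj₁ γ<s)
      in none (u , tree u s s∈T u⊑s
              , ⊏-intro t u (prefixes-⊑ t u s (proj₁ t⊏s) u⊑s (inj₁ t<γ)) t<γ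
              , ⊏-intro u s u⊑s γ<s)

  nextLevel⇒successors : ∀ {T} t s → NextLevel κ T (len t) s → t ⊑ˢ s → Successors κ T t s
  nextLevel⇒successors t s (s∈T , t<s , least) t⊑s =
    s∈T , ⊏-intro t s t⊑s t<s , λ (u , _ , t⊏u , u⊏s) →
      <⇒≱ (⊏⇒len< u s u⊏s) (least (len u) (⊏⇒len< t u t⊏u))

  module Enumeration {T : Subset κ} (κTree : IsκTree κ T) where
    open Bijection (IsκTree.size κTree) public
      using () renaming (to to code; cong to code-cong)
    open Bijection (IsκTree.size κTree) using (injective; surjective)

    nodeIn : Carrier → Σ (Seq κ) T
    nodeIn α = proj₁ (surjective α)

    node : Carrier → Seq κ
    node α = proj₁ (nodeIn α)

    node-code : ∀ x → node (code x) ≈ˢ proj₁ x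
    node-code x = injective {nodeIn (code x)} {x}
      (proj₂ (surjective (code x)) {nodeIn (code x)} (⊑ˢ-refl _ , ⊑ˢ-refl _))

  -- Going through the nodes of T in the order of their codes, keep each node that is comparable
  -- with t and with all the nodes kept before.
  module GreedyBranch {T : Subset κ} (κTree : IsκTree κ T) (t : Seq κ) (t∈T : t ∈ T) where
    open Enumeration κTree

    Comparable : Rel (Seq κ) ℓ
    Comparable s u = s ⊑ˢ u ⊎ u ⊑ˢ s

    comparable-prefix : ∀ r s u → s ⊑ˢ u → Comparable r u → Comparable r s
    comparable-prefix r s u s⊑u (inj₁ r⊑u) = prefixes-comparable r s u r⊑u s⊑u
    comparable-prefix r s u s⊑u (inj₂ u⊑r) = inj₂ (⊑ˢ-trans s u r s⊑u u⊑r)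

    -- Being kept occurs negatively in its own definition, so it is defined by recursion on
    -- accessibility and not as an inductive family.
    KeptAcc : ∀ α → Acc _<_ α → Set ℓ
    KeptAcc α (acc rs) = Comparable t (node α)
      × (∀ β (β<α : β < α) → KeptAcc β (rs β<α) → Comparable (node β) (node α))

    KeptAcc-irrelevant : ∀ α p q → KeptAcc α p → KeptAcc α q
    KeptAcc-irrelevant α (acc rs) (acc rs′) (c , h) =
      c , λ β β<α k → h β β<α (KeptAcc-irrelevant β (rs′ β<α) (rs β<α) k)

    Kept : Pred Carrier ℓ
    Kept α = KeptAcc α (wellFounded α)

    kept : ∀ α → Comparable t (node α) → (∀ β → Kept β → Comparable (node β) (node α)) → Kept α
    kept α c h = go (wellFounded α)
      where
      go : ∀ p → KeptAcc α p
      go (acc rs) = c , λ β β<α k → h β (KeptAcc-irrelevant β _ _ k)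

    kept-t : ∀ α → Kept α → Comparable t (node α)
    kept-t α = go (wellFounded α)
      where
      go : ∀ p → KeptAcc α p → Comparable t (node α)
      go (acc rs) (c , _) = c

    kept-< : ∀ α β → β < α → Kept α → Kept β → Comparable (node β) (node α)
    kept-< α β β<α a b = go (wellFounded α) a
      where
      go : ∀ p → KeptAcc α p → Comparable (node β) (node α)
      go (acc rs) (_ , h) = h β β<α (KeptAcc-irrelevant β _ _ b)

    kept-comparable : ∀ α β → Kept α → Kept β → Comparable (node α) (node β)
    kept-comparable α β a b with compare α β
    ... | tri< α<β _ _  = kept-< β α α<β b a
    ... | tri≈ _ refl _ = inj₁ (⊑ˢ-refl (node α))
    ... | tri> _ _ β<α  = swap (kept-< α β β<α a b)

    Branch : Subset κ
    Branch s = ∃[ α ] Kept α × node α ≈ˢ s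

    -- Comparability passes from `s` to the node enumerated at its code, which is then kept. Both
    -- downward closure and maximality reduce to this.
    branch-intro : ∀ s → s ∈ T → Comparable t s → (∀ α → Kept α → Comparable (node α) s) → s ∈ Branch
    branch-intro s s∈T c h =
      code (s , s∈T) , kept _ (back t c) (λ β k → back (node β) (h β k)) , node-code (s , s∈T)
      where
      back : ∀ r → Comparable r s → Comparable r (node (code (s , s∈T)))
      back r = comparable-prefix r _ s (proj₁ (node-code (s , s∈T)))

    branch-comparable : ∀ s α → s ∈ Branch → Kept α → Comparable (node α) s
    branch-comparable s α (β , b , e) a =
      comparable-prefix (node α) s (node β) (proj₂ e) (kept-comparable α β a b)

    t∈Branch : t ∈ Branch
    t∈Branch = branch-intro t t∈T (inj₁ (⊑ˢ-refl t)) (λ α k → swap (kept-t α k))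

    isBranch : IsBranch κ T Branch
    isBranch = record
      { inTree     = λ {s} → inTree s
      ; linear     = λ { s u s∈B (β , b , e) → swap (comparable-prefix u s s (⊑ˢ-refl s)
                           (swap (comparable-prefix s u (node β) (proj₂ e) (swap (branch-comparable s β s∈B b))))) }
      ; downClosed = λ { s u u∈B@(β , b , e) s⊑u → branch-intro s
                           (IsκTree.isTree κTree s u (inTree u u∈B) s⊑u)
                           (comparable-prefix t s (node β) (⊑ˢ-trans s u (node β) s⊑u (proj₂ e)) (kept-t β b))
                           (λ α a → comparable-prefix (node α) s u s⊑u (branch-comparable u α u∈B a)) }
      }
      where
      inTree : ∀ s → s ∈ Branch → s ∈ T
      inTree s (α , _ , e) = IsκTree.isTree κTree s (node α) (proj₂ (nodeIn α)) (proj₂ e)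

    isMaximalBranch : IsMaximalBranch κ T Branch
    isMaximalBranch = isBranch , λ C isC B⊆C {s} s∈C →
      branch-intro s (IsBranch.inTree isC s∈C)
        (IsBranch.linear isC t s (B⊆C t∈Branch) s∈C)
        (λ α a → IsBranch.linear isC (node α) s
          (B⊆C (α , a , ⊑ˢ-refl (node α) , ⊑ˢ-refl (node α))) s∈C)

-- Extending nodes of regular trees to prescribed lengths.

module Extension {ℓ} (em : ExcludedMiddle (suc ℓ)) (κ : Ordinal ℓ) (inaccessible : StronglyInaccessible κ) where
  open Classical em
  open Ordinal κ
  open OrdinalProperties em κ
  open Smallness em κ inaccessible
  open Sequences em κ

  -- A maximal branch through t has cofinality κ, so the lengths of its nodes are unbounded.
  abstract
    extend : ∀ {T} → IsRegular κ T → ∀ t → t ∈ T → ∀ η →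
             ∃[ s ] s ∈ T × len s ≡ η × (len t ≤ η → t ⊑ˢ s)
    extend {T} reg t t∈T η =
      let s , s∈B , η≤s = long
          s↾ = restrict s η η≤s
      in s↾ , isTree s↾ s (IsBranch.inTree isBranch s∈B) (restrict-⊑ s η η≤s) , refl , λ t≤η →
         prefixes-⊑ t s↾ s
           (comparable-⊑ t s (IsBranch.linear isBranch t s t∈Branch s∈B) (≤-trans t≤η η≤s))
           (restrict-⊑ s η η≤s) t≤η
      where
      open IsRegular reg
      open IsκTree isκTree using (isTree)
      open GreedyBranch isκTree t t∈T
      long : ∃[ s ] s ∈ Branch × η ≤ len s
      long = byContradiction λ none →
        let j = proj₂ (branches Branch isMaximalBranch) (λ _ → Lift ℓ ⊤)
                  (λ x → x , lift tt , ⊑ˢ-refl (proj₁ x))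
            -- The whole branch is cofinal in itself, so `κ` embeds into it. Nodes of a branch are
            -- determined by their lengths; if these all lay below `η`, then `κ` would embed into
            -- `Below η`.
            at : Carrier → Σ (Seq κ) Branch
            at α = proj₁ (Injection.to j α)
        in proj₂ (StronglyInaccessible.cardinal inaccessible η) record
          { to   = λ α → len (proj₁ (at α)) , byContradiction λ ≮η →
                     none (proj₁ (at α) , proj₂ (at α) , ≮⇒≥ ≮η)
          ; cong = λ { refl → refl }
          ; injective = λ {α} {β} e →
              let a , a∈B = at α
                  b , b∈B = at β
                  a~b = IsBranch.linear isBranch a b a∈B b∈B
              in Injection.injective j
                   ( comparable-⊑ a b a~b (inj₂ (cong proj₁ e))
                   , comparable-⊑ b a (swap a~b) (inj₂ (sym (cong proj₁ e))))
          }

-- The tree of approximations and the limit colouring.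

module Stepping {ℓ} (em : ExcludedMiddle (suc ℓ)) (κ : Ordinal ℓ) (weaklyCompact : WeaklyCompact κ)
  (δ σ : Ordinal.Carrier κ) (T : Family κ δ) (reg : ∀ i → IsRegular κ (T i))
  (c : Colouring κ δ σ (⨂ κ δ T)) where
  open Classical em
  open Ordinal κ
  open OrdinalProperties em κ
  open WeaklyCompact weaklyCompact
  open Smallness em κ stronglyInaccessible
  open Sequences em κ
  open Extension em κ stronglyInaccessible

  module T (i : Below δ) where
    open IsRegular (reg i) public using (isκTree)
    open IsκTree isκTree public using (isTree; levels)
    open Enumeration isκTree public

  -- The extension is chosen for the node enumerated by the code of x, so that it depends on x
  -- only up to _≈_.
  extCode : ∀ i α η → ∃[ s ] s ∈ T i × len s ≡ η × (len (T.node i α) ≤ η → T.node i α ⊑ˢ s)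
  extCode i α = extend (reg i) (T.node i α) (proj₂ (T.nodeIn i α))

  ext : ∀ i → Σ (Seq κ) (T i) → Carrier → Σ (Seq κ) (T i)
  ext i x η = let s , s∈T , _ = extCode i (T.code i x) η in s , s∈T

  ext-len : ∀ i x η → len (proj₁ (ext i x η)) ≡ η
  ext-len i x η = proj₁ (proj₂ (proj₂ (extCode i (T.code i x) η)))

  ext-⊒ : ∀ i x η → len (proj₁ x) ≤ η → proj₁ x ⊑ˢ proj₁ (ext i x η)
  ext-⊒ i x η x≤η =
    let n         = T.node i (T.code i x)
        n⊑x , x⊑n = T.node-code i x
    in ⊑ˢ-trans (proj₁ x) n (proj₁ (ext i x η)) x⊑n
         (proj₂ (proj₂ (proj₂ (extCode i (T.code i x) η))) (≤-trans (⊑⇒len≤ n (proj₁ x) n⊑x) x≤η))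

  ext-cong : ∀ i x y η → proj₁ x ≈ˢ proj₁ y → proj₁ (ext i x η) ≡ proj₁ (ext i y η)
  ext-cong i x y η e = cong (λ α → proj₁ (extCode i α η)) (T.code-cong i {x} {y} e)

  lifted : Carrier → Tuple κ δ T → LevelTuple κ δ T
  lifted η x = (λ i → ext i (x i) η) , η , λ i → ext-len i (x i) η

  _≋_ : Rel (Tuple κ δ T) ℓ
  _≋_ = Setoid._≈_ (∏ κ δ T)

  liftedColour : Carrier → Tuple κ δ T → Below σ
  liftedColour η x = Func.to c (lifted η x)

  liftedColour-cong : ∀ η x y → x ≋ y → liftedColour η x ≡ liftedColour η y
  liftedColour-cong η x y e = Func.cong c {lifted η x} {lifted η y} λ i →
    subst (proj₁ (ext i (x i) η) ≈ˢ_) (ext-cong i (x i) (y i) η (e i))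
      (⊑ˢ-refl _ , ⊑ˢ-refl _)

  Bounded : Tuple κ δ T → Carrier → Set ℓ
  Bounded x ξ = ∀ i → len (proj₁ (x i)) ≤ ξ

  Agree : Carrier → Rel Carrier ℓ
  Agree ξ η η′ = ∀ x → Bounded x ξ → liftedColour η x ≡ liftedColour η′ x

  abstract
    -- An ordinal code for the restriction of `liftedColour η` to the tuples bounded by `ξ`, which
    -- lets such restrictions be the values of a sequence in `κ`.
    rep : Carrier → Carrier → Carrier
    rep ξ η = proj₁ (least (Agree ξ η) (η , λ _ _ → refl))

    rep-agrees : ∀ ξ η → Agree ξ η (rep ξ η)
    rep-agrees ξ η = proj₁ (proj₂ (least (Agree ξ η) (η , λ _ _ → refl)))

    rep-cong : ∀ ξ η η′ → Agree ξ η η′ → rep ξ η ≡ rep ξ η′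
    rep-cong ξ η η′ a = least-cong
      (λ _ b x p → trans (sym (a x p)) (b x p)) (λ _ b x p → trans (a x p) (b x p)) _ _

  rep-≡⇒agree : ∀ ξ η η′ → rep ξ η ≡ rep ξ η′ → Agree ξ η η′
  rep-≡⇒agree ξ η η′ e x p = trans (rep-agrees ξ η x p)
    (trans (cong (λ θ → liftedColour θ x) e) (sym (rep-agrees ξ η′ x p)))

  -- A node of length ζ records, for each ξ < ζ, the colouring liftedColour η restricted to the
  -- tuples of nodes of length ≤ ξ, for some η ≥ ζ.
  Records : Seq κ → Carrier → Set ℓ
  Records s η = len s ≤ η × (∀ ξ (p : ξ < len s) → val s (ξ , p) ≡ rep ξ η)

  ApproxTree : Subset κ
  ApproxTree s = ∃ (Records s)

  approxSetoid : Setoid ℓ ℓ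
  approxSetoid = subsetoid (seqSetoid κ) ApproxTree

  records-⊑ : ∀ s u η → s ⊑ˢ u → Records u η → Records s η
  records-⊑ s u η s⊑u (u≤η , h) = ≤-trans (⊑⇒len≤ s u s⊑u) u≤η , λ ξ p →
    let q , e = s⊑u ξ p in trans e (h ξ q)

  records⇒≈ : ∀ s u η η′ → Records s η → Records u η′ → len s ≡ len u →
              (∀ ξ → ξ < len s → rep ξ η ≡ rep ξ η′) → s ≈ˢ u
  records⇒≈ s u η η′ (_ , h) (_ , h′) e same =
      (λ ξ p → let q = subst (ξ <_) e p in q , trans (h ξ p) (trans (same ξ p) (sym (h′ ξ q))))
    , (λ ξ q → let p = subst (ξ <_) (sym e) q in p , trans (h′ ξ q) (sym (trans (h ξ p) (same ξ p))))

  records⇒agree : ∀ s u η η′ → s ⊑ˢ u → Records s η → Records u η′ →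
                  ∀ ξ → ξ < len s → Agree ξ η η′
  records⇒agree s u η η′ s⊑u (_ , h) (_ , h′) ξ p = rep-≡⇒agree ξ η η′
    (let q , e = s⊑u ξ p in trans (sym (h ξ p)) (trans e (h′ ξ q)))

  -- Regularity is used three times: along a single level, over the levels up to `ζ`, and over the
  -- trees indexed by `δ`.
  codesBelow : ∀ ζ → ∃[ μ ] (∀ i x → len (proj₁ x) ≤ ζ → T.code i x < μ)
  codesBelow ζ = collectBelow δ (λ i μ → ∀ x → len (proj₁ x) ≤ ζ → T.code i x < μ)
    (λ μ≤μ′ h x p → <-≤-trans (h x p) μ≤μ′) λ i →
    let θ , ζ<θ = above ζ
        μ , h = collectBelow θ (λ (ξ , _) μ → ∀ x → len (proj₁ x) ≡ ξ → T.code i x < μ)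
          (λ μ≤μ′ h x p → <-≤-trans (h x p) μ≤μ′)
          (λ (ξ , _) →
            let μ , h = bounded (subsetoid (seqSetoid κ) (Level[_] κ (T i) ξ)) (proj₂ (T.levels i ξ)) record
                  { to   = λ (s , s∈T , _) → T.code i (s , s∈T)
                  ; cong = λ {(s , s∈T , _)} {(u , u∈T , _)} e → T.code-cong i {s , s∈T} {u , u∈T} e }
            in μ , λ (s , s∈T) e → h (s , s∈T , e))
    in μ , λ x p → h (len (proj₁ x) , ≤-<-trans p ζ<θ) x refl

  -- These are the tuples whose colours a node of length `ζ` determines; the bound `ξ` below `ζ` is
  -- common to all coordinates.
  shortTuples : Carrier → Setoid ℓ ℓ
  shortTuples ζ = subsetoid (∏ κ δ T) (λ x → ∃[ ξ ] ξ < ζ × Bounded x ξ)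

  -- A tuple is determined by the codes of its entries, a function from `Below δ` to `Below μ`.
  small-shortTuples : ∀ ζ → Small (shortTuples ζ)
  small-shortTuples ζ = small-≼ codes (small-⇨ (small-Below δ) (small-Below μ))
    where
    μ = proj₁ (codesBelow ζ)
    codes : shortTuples ζ ≼ (setoid (Below δ) ⇨ setoid (Below μ))
    codes = record
      { to = λ (x , ξ , ξ<ζ , b) → record
        { to   = λ i → T.code i (x i) , proj₂ (codesBelow ζ) i (x i) (≤-trans (b i) (inj₁ ξ<ζ))
        ; cong = λ { refl → refl } }
      ; cong = λ {(x , _)} {(y , _)} e i → Below-≡ (T.code-cong i {x i} {y i} (e i))
      ; injective = λ {(x , _)} {(y , _)} e i →
          Bijection.injective (IsκTree.size (T.isκTree i)) {x i} {y i} (cong proj₁ (e i))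
      }

  -- A node of length `ζ` amounts to a colouring of `shortTuples ζ`. Different witnesses `η` for
  -- equal nodes induce the same colouring there.
  small-level : ∀ ζ → Small (subsetoid (seqSetoid κ) (Level[_] κ ApproxTree ζ))
  small-level ζ = small-≼ colouring (small-⇨ (small-shortTuples ζ) (small-Below σ))
    where
    colouring : subsetoid (seqSetoid κ) (Level[_] κ ApproxTree ζ) ≼ (shortTuples ζ ⇨ setoid (Below σ))
    colouring = record
      { to = λ (s , (η , _) , _) → record
        { to   = λ (x , _) → liftedColour η x
        ; cong = λ {(x , _)} {(y , _)} → liftedColour-cong η x y }
      ; cong = λ { {(s , (η , r) , refl)} {(u , (η′ , r′) , _)} e (x , ξ , ξ<ζ , b) →
          records⇒agree s u η η′ (proj₁ e) r r′ ξ ξ<ζ x b }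
      ; injective = λ { {(s , (η , r) , refl)} {(u , (η′ , r′) , e′)} e →
          records⇒≈ s u η η′ r r′ (sym e′) λ ξ ξ<s →
            rep-cong ξ η η′ λ x b → e (x , ξ , ξ<s , b) }
      }

  -- The length and the least recorded `η` determine a node, since its values are `rep ξ η`.
  approxKey : approxSetoid ≼ setoid (Carrier × Carrier)
  approxKey = record
    { to = λ (s , m) → len s , proj₁ (least (Records s) m)
    ; cong = λ {(s , m)} {(u , n)} e → cong₂ _,_ (≈⇒len≡ s u e)
        (least-cong (λ η → records-⊑ u s η (proj₂ e)) (λ η → records-⊑ s u η (proj₁ e)) m n)
    ; injective = λ {(s , m)} {(u , n)} e →
        records⇒≈ s u _ _ (proj₁ (proj₂ (least (Records s) m))) (proj₁ (proj₂ (least (Records u) n)))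
          (cong proj₁ e) (λ ξ _ → cong (rep ξ) (cong proj₂ e))
    }

  -- Letting `ζ` itself be the recorded ordinal yields a node of every length, hence `κ` distinct
  -- nodes.
  diagonal : asSet ≼ approxSetoid
  diagonal = record
    { to        = λ ζ → ⟨ ζ , (λ (ξ , _) → rep ξ ζ) ⟩ , ζ , inj₂ refl , λ ξ p → refl
    ; cong      = λ { refl → ⊑ˢ-refl _ , ⊑ˢ-refl _ }
    ; injective = λ {ζ} {ζ′} e → ≈⇒len≡ ⟨ ζ , (λ (ξ , _) → rep ξ ζ) ⟩ ⟨ ζ′ , (λ (ξ , _) → rep ξ ζ′) ⟩ e
    }

  approxTree : IsκTree κ ApproxTree
  approxTree = record
    { isTree = λ s u (η , r) s⊑u → η , records-⊑ s u η s⊑u r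
    ; size   = Collapse.bijection approxSetoid approxKey
        -- The fibre of `approxKey` over `ζ` is the level `ζ`, which is small.
        (λ ζ j → proj₂ (small⇒≺ (small-level ζ)) (injection j record
          { to = λ ((s , m) , e) → s , m , e ; cong = λ e → e ; injective = λ e → e }))
        diagonal
    ; levels = λ ζ → small⇒≺ (small-level ζ)
    }

  abstract
    cofinal : ∃[ B ] IsCofinalBranch κ ApproxTree B
    cofinal = treeProperty ApproxTree approxTree

  branch : Carrier → Seq κ
  branch ζ = proj₁ (proj₂ (proj₂ cofinal) ζ)

  branch-len : ∀ ζ → len (branch ζ) ≡ ζ
  branch-len ζ = proj₂ (proj₂ (proj₂ (proj₂ cofinal) ζ))

  branch-recorded : ∀ ζ → ApproxTree (branch ζ)
  branch-recorded ζ = IsBranch.inTree (proj₁ (proj₂ cofinal)) (proj₁ (proj₂ (proj₂ (proj₂ cofinal) ζ)))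

  stage : Carrier → Carrier
  stage ζ = proj₁ (branch-recorded ζ)

  ≤-stage : ∀ ζ → ζ ≤ stage ζ
  ≤-stage ζ = subst (_≤ stage ζ) (branch-len ζ) (proj₁ (proj₂ (branch-recorded ζ)))

  -- Nodes of the branch are comparable, so those of lengths `ζ` and `ζ′` have the same value at
  -- `ξ`, and this value codes the restricted colouring.
  stages-agree : ∀ ξ ζ ζ′ → ξ < ζ → ξ < ζ′ → Agree ξ (stage ζ) (stage ζ′)
  stages-agree ξ ζ ζ′ ξ<ζ ξ<ζ′ x b
    with IsBranch.linear (proj₁ (proj₂ cofinal)) (branch ζ) (branch ζ′)
           (proj₁ (proj₂ (proj₂ (proj₂ cofinal) ζ))) (proj₁ (proj₂ (proj₂ (proj₂ cofinal) ζ′)))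
  ... | inj₁ p = records⇒agree (branch ζ) (branch ζ′) _ _ p (proj₂ (branch-recorded ζ)) (proj₂ (branch-recorded ζ′))
                   ξ (subst (ξ <_) (sym (branch-len ζ)) ξ<ζ) x b
  ... | inj₂ p = sym (records⇒agree (branch ζ′) (branch ζ) _ _ p (proj₂ (branch-recorded ζ′)) (proj₂ (branch-recorded ζ))
                   ξ (subst (ξ <_) (sym (branch-len ζ′)) ξ<ζ′) x b)

  -- Fewer than `κ` lengths are bounded, by regularity.
  lengthBound : ∀ x → ∃ (Bounded x)
  lengthBound x = collectBelow δ (λ i ν → len (proj₁ (x i)) ≤ ν) (λ ν≤ν′ p → ≤-trans p ν≤ν′)
    (λ i → _ , inj₂ refl)

  limitColour : Tuple κ δ T → Below σ
  limitColour x = liftedColour (stage (proj₁ (above (proj₁ (lengthBound x))))) x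

  limitColour-stage : ∀ x ξ ζ → Bounded x ξ → ξ < ζ → limitColour x ≡ liftedColour (stage ζ) x
  limitColour-stage x ξ ζ b ξ<ζ with ≤-total ξ (proj₁ (lengthBound x))
  ... | inj₁ ξ≤ξ₀ = stages-agree ξ _ ζ (≤-<-trans ξ≤ξ₀ (proj₂ (above _))) ξ<ζ x b
  ... | inj₂ ξ₀≤ξ = stages-agree _ _ ζ (proj₂ (above _)) (≤-<-trans ξ₀≤ξ ξ<ζ) x (proj₂ (lengthBound x))

  limitColouring : Colouring κ δ σ (∏ κ δ T)
  limitColouring = record
    { to   = limitColour
    -- `lengthBound y` may differ from `lengthBound x`, but the latter also bounds `y`, so both
    -- colours can be read at one stage.
    ; cong = λ {x} {y} x≈y → trans (liftedColour-cong _ x y x≈y) (sym (limitColour-stage y _ _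
        (λ i → subst (_≤ _) (≈⇒len≡ (proj₁ (x i)) (proj₁ (y i)) (x≈y i)) (proj₂ (lengthBound x) i))
        (proj₂ (above _))))
    }

  -- From a somewhere dense matrix to dominating sets on one level.

  module Transfer (X : Family κ δ) (X⊆T : _⊆ᶠ_ κ δ X T)
    (t : Below δ → Seq κ) (t∈T : ∀ i → t i ∈ T i) (ζ : Carrier) (t-len : ∀ i → len (t i) ≡ ζ)
    (dominates : ∀ i → _Dominates_ κ (X i) (Successors κ (T i) (t i))) where

    DominatedWithin : ∀ i → Carrier → Seq κ → Set ℓ
    DominatedWithin i ν y = ∃[ x ] x ∈ X i × y ⊑ˢ x × len x ≤ ν

    -- Levels of T i are small, so the nodes witnessing domination may be chosen of bounded length.
    dominatedWithin : ∃[ ν ] (∀ i y → Successors κ (T i) (t i) y → DominatedWithin i ν y)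
    dominatedWithin = collectBelow δ (λ i ν → ∀ y → Successors κ (T i) (t i) y → DominatedWithin i ν y)
      (λ ν≤ν′ h y y∈ → let x , x∈X , y⊑x , x≤ν = h y y∈ in x , x∈X , y⊑x , ≤-trans x≤ν ν≤ν′)
      λ i →
        -- Successors of `t i` all lie on the single level `θ`, one above `ζ`.
        let θ , succ = successor ζ
            level : ∀ y → Successors κ (T i) (t i) y → Level[_] κ (T i) θ y
            level y y∈ =
              let y∈T , t<y , y-least = successors⇒nextLevel (T.isTree i) (t i) y y∈ in
              y∈T , ≤-antisym (y-least θ (subst (_< θ) (sym (t-len i)) (proj₁ succ)))
                              (proj₂ succ (len y) (subst (_< len y) (t-len i) t<y))
            ν , h = collect (subsetoid (seqSetoid κ) (Successors κ (T i) (t i)))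
              (λ j → proj₂ (T.levels i θ) (injection j (subsetoid-≼ (seqSetoid κ) level)))
              (λ (y , _) ν → DominatedWithin i ν y)
              (λ {(y , _)} {(y′ , _)} e (x , x∈X , y⊑x , x≤ν) →
                x , x∈X , ⊑ˢ-trans y′ y x (proj₂ e) y⊑x , x≤ν)
              (λ ν≤ν′ (x , x∈X , y⊑x , x≤ν) → x , x∈X , y⊑x , ≤-trans x≤ν ν≤ν′)
              (λ (y , y∈) → let x , x∈X , y⊑x = dominates i y y∈ in len x , x , x∈X , y⊑x , inj₂ refl)
        in ν , λ y y∈ → h (y , y∈)

    ν : Carrier
    ν = proj₁ dominatedWithin

    -- Exceeding `ν` makes this stage compute the limit colouring on tuples of length at most `ν`;
    -- exceeding `ζ` puts `η` above `ζ`.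
    top : ∃[ ζ₁ ] ν < ζ₁ × ζ < ζ₁
    top = let θ , ν≤θ , ζ≤θ = upperBound ν ζ
              ζ₁ , θ<ζ₁ = above θ
          in ζ₁ , ≤-<-trans ν≤θ θ<ζ₁ , ≤-<-trans ζ≤θ θ<ζ₁

    η : Carrier
    η = stage (proj₁ top)

    ν≤η : ν ≤ η
    ν≤η = inj₁ (<-≤-trans (proj₁ (proj₂ top)) (≤-stage _))

    ζ<η : ζ < η
    ζ<η = <-≤-trans (proj₂ (proj₂ top)) (≤-stage _)

    -- Only matrix elements of length at most `ν` are lifted: for these the limit colour is the
    -- colour at level `η`, and the lift is an actual extension because `ν ≤ η`.
    Y : Family κ δ
    Y i s = Σ[ x ∈ Seq κ ] Σ[ x∈X ∈ x ∈ X i ] len x ≤ ν × s ≡ proj₁ (ext i (x , X⊆T i x∈X) η)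

    Y⊆level : _⊆ᶠ_ κ δ Y (λ i → Level[_] κ (T i) η)
    Y⊆level i (x , x∈X , _ , refl) = proj₂ (ext i (x , X⊆T i x∈X) η) , ext-len i (x , X⊆T i x∈X) η

    Y-dominates : ∀ i y → NextLevel κ (T i) ζ y → t i ⊑ˢ y → ∃[ s ] s ∈ Y i × y ⊑ˢ s
    Y-dominates i y next t⊑y =
      let x , x∈X , y⊑x , x≤ν = proj₂ dominatedWithin i y (nextLevel⇒successors (t i) y
            (subst (λ ζ → NextLevel κ (T i) ζ y) (sym (t-len i)) next) t⊑y)
          s = proj₁ (ext i (x , X⊆T i x∈X) η)
      in s , (x , x∈X , x≤ν , refl)
           , ⊑ˢ-trans y x s y⊑x (ext-⊒ i (x , X⊆T i x∈X) η (≤-trans x≤ν ν≤η))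

    -- The single colour has to be attained, so `Y` must have a level tuple. Each `t i` extends to a
    -- node one level up, and `Y i` dominates that node.
    element : LevelTuple κ δ Y
    element = (λ i → proj₁ (y i) , proj₁ (proj₂ (y i))) , η , λ i → proj₂ (Y⊆level i (proj₁ (proj₂ (y i))))
      where
      y : ∀ i → ∃[ s ] s ∈ Y i × _
      y i = let θ , succ = successor ζ
                u , u∈T , u-len , t⊑u = extend (reg i) (t i) (t∈T i) θ
            in Y-dominates i u (u∈T , subst (IsSuccessorOf ζ) (sym u-len) succ)
                 (t⊑u (subst (_≤ θ) (sym (t-len i)) (inj₁ (proj₁ succ))))

    source : LevelTuple κ δ Y → Tuple κ δ X
    source (y , _) i = let _ , x , x∈X , _ = y i in x , x∈X

    -- A tuple of `Y` is the lift to level `η` of its source, so its colour is `liftedColour η` of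
    -- the source; `limitColour-stage` applies because the source is bounded by `ν`.
    colour-source : ∀ y → Func.to c (⨂-incl κ δ {Y} {T} (λ i s∈Y → proj₁ (Y⊆level i s∈Y)) y)
                        ≡ limitColour (∏-incl κ δ {X} {T} X⊆T (source y))
    colour-source y@(y₀ , _) = trans
      (Func.cong c {⨂-incl κ δ {Y} {T} (λ i s∈Y → proj₁ (Y⊆level i s∈Y)) y} {lifted η x} λ i →
        subst (proj₁ (y₀ i) ≈ˢ_) (proj₂ (proj₂ (proj₂ (proj₂ (y₀ i))))) (⊑ˢ-refl _ , ⊑ˢ-refl _))
      (sym (limitColour-stage x ν (proj₁ top) (λ i → proj₁ (proj₂ (proj₂ (proj₂ (y₀ i))))) (proj₁ (proj₂ top))))
      where
      x = ∏-incl κ δ {X} {T} X⊆T (source y)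

-- The two implications.

SDHL'⇒SDHL : ∀ {ℓ} → ExcludedMiddle (suc ℓ) → (κ : Ordinal ℓ) → WeaklyCompact κ →
             ∀ δ σ → SDHL' κ δ σ → SDHL κ δ σ
SDHL'⇒SDHL em κ weaklyCompact δ σ sdhl′ T reg c =
  let open Stepping em κ weaklyCompact δ σ T reg c
      X , (X⊆T , t , t∈T , (ζ , t-len) , dominates) , constant = sdhl′ T reg limitColouring
      open Transfer X X⊆T t t∈T ζ t-len dominates
  in ζ , η , ζ<η , t , (λ i → t∈T i , t-len i) , Y , Y⊆level
     , (λ i y (next , t⊑y) → Y-dominates i y next t⊑y)
     , _ , (element , refl) , λ { (y , refl) →
         trans (colour-source element) (trans (constant (source element) (source y)) (sym (colour-source y))) }

SDHL⇒SDHL' : ∀ {ℓ} → ExcludedMiddle (suc ℓ) → (κ : Ordinal ℓ) → ∀ δ σ → SDHL κ δ σ → SDHL' κ δ σ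
SDHL⇒SDHL' em κ δ σ sdhl T reg c =
  let open Sequences em κ
      ζ , ζ′ , _ , t , t∈ , X , X⊆ , dominates , γ , _ , unique = sdhl T reg record
        { to = λ (x , _) → Func.to c x ; cong = λ {(x , _)} {(y , _)} e → Func.cong c {x} {y} e }
      -- All of `X i` lies on level `ζ′`, so every tuple of the full product of `X` is already a
      -- level tuple.
      level : Tuple κ δ X → LevelTuple κ δ X
      level x = x , ζ′ , λ i → proj₂ (X⊆ i (proj₂ (x i)))
  in X
     , ((λ i x∈X → proj₁ (X⊆ i x∈X)) , t , (λ i → proj₁ (t∈ i)) , (ζ , λ i → proj₂ (t∈ i))
       , λ i y y∈ → dominates i y
           ( subst (λ ζ → NextLevel κ (T i) ζ y) (proj₂ (t∈ i))
               (successors⇒nextLevel (IsκTree.isTree (IsRegular.isκTree (reg i))) (t i) y y∈)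
           , proj₁ (proj₁ (proj₂ y∈))))
     , λ x y → trans (sym (unique (level x , refl))) (unique (level y , refl))

theorem3p5 : ∀ {ℓ} → ExcludedMiddle (suc ℓ) →
    (κ : Ordinal ℓ) → WeaklyCompact κ →
    (δ σ : Ordinal.Carrier κ) →
    Ordinal.Positive κ δ → Ordinal.Positive κ σ →
    SDHL' κ δ σ ⇔ SDHL κ δ σ
theorem3p5 em κ weaklyCompact δ σ _ _ =
  mk⇔ (SDHL'⇒SDHL em κ weaklyCompact δ σ) (SDHL⇒SDHL' em κ δ σ)
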